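{- Let $q$ be a prime power, $n$ a positive integer, and $t$ a nontrivial divisor of $n$ (that is, $t\mid n$ and $1<t<n$). Let $f\in\mathcal{L}_{n,q}$. (i) If $f$ is R-$q^t$-partially scattered, then $w_{L_f}(P)\le n/2$ for every point $P\in\mathrm{PG}(1,q^n)$. (ii) If $f$ is L-$q^t$-partially scattered, then $w_{L_f}(P)\le t$ for every point $P\in\mathrm{PG}(1,q^n)$.
   Context: $\mathcal{L}_{n,q}$ is the set of $q$-polynomials $\sum_{i=0}^{n-1}a_ix^{q^i}$ with $a_i\in\mathbb{F}_{q^n}$, identified with the $\mathbb{F}_q$-linear endomorphisms of $\mathbb{F}_{q^n}$. The graph of $f$ is the $\mathbb{F}_q$-subspace $\mathcal{G}_f=\{(y,f(y)) : y\in\mathbb{F}_{q^n}\}$ of $\mathbb{F}_{q^n}^2$, and $L_f=\{\langle(y,f(y))\rangle_{\mathbb{F}_{q^n}} : y\in\mathbb{F}_{q^n}^*\}\subseteq\mathrm{PG}(1,q^n)$. The weight of a point $P=\langle v\rangle_{\mathbb{F}_{q^n}}$ ($0\ne v\in\mathbb{F}_{q^n}^2$) in $L_f$ is $w_{L_f}(P)=\dim_{\mathbb{F}_q}(\mathcal{G}_f\cap\langle v\rangle_{\mathbb{F}_{q^n}})$. The polynomial $f$ is L-$q^t$-partially scattered if for all $y,z\in\mathbb{F}_{q^n}^*$, $\frac{f(y)}{y}=\frac{f(z)}{z}$ implies $\frac{y}{z}\in\mathbb{F}_{q^t}$. It is R-$q^t$-partially scattered if for all $y,z\in\mathbb{F}_{q^n}^*$,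 $\frac{f(y)}{y}=\frac{f(z)}{z}$ and $\frac{y}{z}\in\mathbb{F}_{q^t}$ imply $\frac{y}{z}\in\mathbb{F}_q$. -}

module Defs where

open import Algebra.Bundles using (CommutativeRing)
open import Algebra.Definitions using (Invertible)
open import Algebra.Module.Bundles using (Module)
import Algebra.Module.Construct.DirectProduct as DirectProduct
import Algebra.Module.Construct.TensorUnit as TensorUnit
import Algebra.Properties.Monoid.Sum as Sum
import Algebra.Properties.Semiring.Exp as Exp
open import Data.Fin.Base using (Fin; toℕ)
open import Data.Nat.Base as ℕ using (ℕ)
open import Data.Nat.Primality using (Prime)
open import Data.Product.Base using (Σ-syntax; ∃-syntax; _×_; _,_; proj₁; proj₂)
open import Data.Vec.Functional using (Vector)
open import Function.Bundles using (Bijection)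
open import Level using (Level; _⊔_; suc)
open import Relation.Binary.Bundles using (Setoid)
import Relation.Binary.Construct.On as On
open import Relation.Binary.Definitions using (_Respects_)
open import Relation.Binary.PropositionalEquality using (_≡_; setoid)
open import Relation.Nullary.Negation using (¬_)
open import Relation.Unary using (Pred; _∈_; _∩_; _≐_)

IsPrimePower : ℕ → Set
IsPrimePower q = ∃[ p ] ∃[ k ] (Prime p × 1 ℕ.≤ k × q ≡ p ℕ.^ k)

HasOrder : ∀ {a ℓ} → Setoid a ℓ → ℕ → Set (a ⊔ ℓ)
HasOrder S m = Bijection (setoid (Fin m)) S

record Field (c ℓ : Level) : Set (suc (c ⊔ ℓ)) where
  field
    commutativeRing : CommutativeRing c ℓ

  open CommutativeRing commutativeRing public

  field
    0≉1        : ¬ (0# ≈ 1#)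
    invertible : ∀ x → ¬ (x ≈ 0#) → Invertible _≈_ 1# _*_ x

  Carrier* : Set (c ⊔ ℓ)
  Carrier* = Σ[ x ∈ Carrier ] ¬ (x ≈ 0#)

  infix 8 _⁻¹
  _⁻¹ : Carrier* → Carrier
  (x , x≉0) ⁻¹ = proj₁ (invertible x x≉0)

  infixl 7 _/_
  _/_ : Carrier → Carrier* → Carrier
  x / y = x * y ⁻¹

record Subfield {c ℓ} (K : Field c ℓ) (s : Level) : Set (c ⊔ ℓ ⊔ suc s) where
  open Field K
  field
    ⟦_⟧        : Pred Carrier s
    resp       : ⟦_⟧ Respects _≈_
    0-closed   : 0# ∈ ⟦_⟧
    1-closed   : 1# ∈ ⟦_⟧
    +-closed   : ∀ {x y} → x ∈ ⟦_⟧ → y ∈ ⟦_⟧ → (x + y) ∈ ⟦_⟧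
    *-closed   : ∀ {x y} → x ∈ ⟦_⟧ → y ∈ ⟦_⟧ → (x * y) ∈ ⟦_⟧
    neg-closed : ∀ {x} → x ∈ ⟦_⟧ → (- x) ∈ ⟦_⟧
    ⁻¹-closed  : ∀ (x : Carrier*) → proj₁ x ∈ ⟦_⟧ → (x ⁻¹) ∈ ⟦_⟧

  subsetoid : Setoid (c ⊔ s) ℓ
  subsetoid = On.setoid (Field.setoid K) (proj₁ {B = ⟦_⟧})

module _ {c ℓ s v ℓv} (K : Field c ℓ) (F : Subfield K s)
         (V : Module (Field.commutativeRing K) v ℓv) where
  open Field K using (Carrier; _≈_; 0#)
  open Subfield F using (⟦_⟧)
  open Module V using (Carrierᴹ; _≈ᴹ_; _*ₗ_; 0ᴹ; +ᴹ-monoid)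
  open Sum +ᴹ-monoid using (sum)

  combination : ∀ {d} → Vector Carrier d → Vector Carrierᴹ d → Carrierᴹ
  combination a b = sum (λ i → a i *ₗ b i)

  LinearlyIndependent : ∀ {d} → Vector Carrierᴹ d → Set (c ⊔ ℓ ⊔ s ⊔ ℓv)
  LinearlyIndependent b =
    ∀ a → (∀ i → a i ∈ ⟦_⟧) → combination a b ≈ᴹ 0ᴹ → ∀ i → a i ≈ 0#

  Span : ∀ {d} → Vector Carrierᴹ d → Pred Carrierᴹ (c ⊔ s ⊔ ℓv)
  Span b u = ∃[ a ] ((∀ i → a i ∈ ⟦_⟧) × u ≈ᴹ combination a b)

  IsBasis : ∀ {u d} → Pred Carrierᴹ u → Vector Carrierᴹ d → Set (c ⊔ ℓ ⊔ s ⊔ v ⊔ ℓv ⊔ u)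
  IsBasis U b = LinearlyIndependent b × U ≐ Span b

  -- In particular, U has a dimension only if it is an F-subspace.
  HasDimension : ∀ {u} → Pred Carrierᴹ u → ℕ → Set (c ⊔ ℓ ⊔ s ⊔ v ⊔ ℓv ⊔ u)
  HasDimension U d = Σ[ b ∈ Vector Carrierᴹ d ] IsBasis U b

module QPolynomials {c ℓ} (K : Field c ℓ) (q n : ℕ) where
  open Field K
  open Exp semiring using (_^_)
  open Sum +-monoid using (sum)

  -- Coefficient i is the coefficient of x^(q^i), 0 ≤ i ≤ n-1.
  QPolynomial : Set c
  QPolynomial = Vector Carrier n

  eval : QPolynomial → Carrier → Carrier
  eval f y = sum (λ i → f i * y ^ (q ℕ.^ toℕ i))

  slope : QPolynomial → Carrier* → Carrier
  slope f y = eval f (proj₁ y) / y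

  LPartiallyScattered : ∀ {s} → Subfield K s → QPolynomial → Set (c ⊔ ℓ ⊔ s)
  LPartiallyScattered Fqt f =
    ∀ (y z : Carrier*) → slope f y ≈ slope f z →
    (proj₁ y / z) ∈ Subfield.⟦_⟧ Fqt

  RPartiallyScattered : ∀ {s s′} → Subfield K s → Subfield K s′ → QPolynomial →
                        Set (c ⊔ ℓ ⊔ s ⊔ s′)
  RPartiallyScattered Fq Fqt f =
    ∀ (y z : Carrier*) → slope f y ≈ slope f z →
    (proj₁ y / z) ∈ Subfield.⟦_⟧ Fqt →
    (proj₁ y / z) ∈ Subfield.⟦_⟧ Fq

  K² : Module commutativeRing c ℓ
  K² = DirectProduct.⟨module⟩ TensorUnit.⟨module⟩ TensorUnit.⟨module⟩

  open Module K² using (Carrierᴹ; _≈ᴹ_; _*ₗ_; 0ᴹ)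

  Graph : QPolynomial → Pred Carrierᴹ (c ⊔ ℓ)
  Graph f u = ∃[ y ] (u ≈ᴹ (y , eval f y))

  -- Points of PG(1,qⁿ) are given by nonzero representatives; every notion below
  -- depends on a point P only through the line ⟨ P ⟩.
  Point : Set (c ⊔ ℓ)
  Point = Σ[ v ∈ Carrierᴹ ] ¬ (v ≈ᴹ 0ᴹ)

  ⟨_⟩ : Point → Pred Carrierᴹ (c ⊔ ℓ)
  ⟨ v , _ ⟩ u = ∃[ k ] (u ≈ᴹ k *ₗ v)

  HasWeight : ∀ {s} → Subfield K s → QPolynomial → Point → ℕ → Set (c ⊔ ℓ ⊔ s)
  HasWeight Fq f P w = HasDimension K Fq K² (Graph f ∩ ⟨ P ⟩) w

{-# OPTIONS --safe #-}
module Submission where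

-- Characteristic p makes f additive and Fermat's theorem on F_q makes it F_q-homogeneous, so
-- U = G_f ∩ ⟨P⟩ is an F_q-subspace; its elements are determined by their first coordinates, and the
-- nonzero ones all have the same slope. Both bounds then come from counting, with w = dim U.
-- In (ii), dividing the first coordinates by a fixed nonzero one embeds U into F_{q^t}, so q^w ≤ q^t.
-- In (i), for μ ∈ F_{q^t} ∖ F_q the map (u , u′) ↦ u₁ + μu′₁ embeds U × U into K, so q^{2w} ≤ q^n.

open import Defs
import Algebra.Properties.CommutativeMonoid.Sum as CommutativeMonoidSum
import Algebra.Properties.CommutativeSemiring.Binomial as Binomial
import Algebra.Properties.CommutativeSemiring.Exp as CommutativeSemiringExp
import Algebra.Properties.Group as GroupProperties
import Algebra.Properties.Ring as RingProperties
import Algebra.Properties.Semiring.Mult as SemiringMult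
import Algebra.Properties.Semiring.Sum as SemiringSum
open import Algebra.Module.Bundles using (Module)
import Algebra.Solver.Ring.NaturalCoefficients.Default as SemiringSolver
open import Data.Bool.Base using (if_then_else_)
open import Data.Empty using (⊥-elim)
open import Data.Fin.Base using (Fin; zero; suc; toℕ; fromℕ; inject₁; punchIn; finToFun; funToFin; combine; remQuot)
open import Data.Fin.Permutation using (Permutation′; permutation; _⟨$⟩ʳ_)
import Data.Fin.Properties as Fin
open import Data.Nat.Base as ℕ using (ℕ; zero; suc; _≤_; _<_; _!; _∸_; s≤s; z≤n)
open import Data.Nat.Combinatorics using (_C_; nCk≡n!/k![n-k]!; k![n∸k]!∣n!; nCn≡1)
open import Data.Nat.Divisibility using (_∣_; divides-refl; ∣⇒≤; ∣1⇒≡1; m∣m*n)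
open import Data.Nat.DivMod using (m/n*n≡m)
open import Data.Nat.Primality using (Prime; euclidsLemma; prime⇒nonZero; prime⇒nonTrivial)
import Data.Nat.Properties as ℕ
open import Data.Product.Base using (Σ-syntax; ∃; ∃-syntax; _×_; _,_; proj₁; proj₂)
open import Data.Sum.Base using (inj₁; inj₂; [_,_]′)
open import Data.Vec.Functional using (Vector; []; _∷_)
open import Function.Base using (_∘_)
open import Function.Bundles using (Bijection)
open import Level using (Level; _⊔_)
open import Relation.Binary.Bundles using (Setoid)
open import Relation.Binary.Definitions using (_Respects_)
open import Relation.Binary.PropositionalEquality as ≡ using (_≡_; _≢_)
import Relation.Binary.Reasoning.Setoid as SetoidReasoning
open import Relation.Nullary.Decidable using (Dec; yes; no; map′; does; ¬?; _×-dec_)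
open import Relation.Nullary.Negation using (¬_; contradiction)
open import Relation.Unary using (Pred; _∈_; _∉_; _⊆_; _∩_; Decidable)

-- Only the orders of the fields are given, so the characteristic has to be recovered from the order
-- of `K` before `f` can be shown additive. A weight is asserted by exhibiting a basis, so `U` must
-- be given one constructively: finiteness makes equality in `K`, membership in `U` and membership
-- in a span decidable, and a greedy extension then stops because independent families in a finite
-- set are short. The embedding in (i) says that the space of first coordinates of `U` meets its
-- multiple by μ only in 0: a common nonzero element would yield two elements of equal slope and
-- ratio μ, and R-scatteredness would then put μ into F_q. Counting takes the place of dimension
-- theory for `K` and F_{q^t}: their orders are powers of q, so comparing exponents is enough.

-- Binomial coefficients modulo a prime, and growth of powers.

prime∤! : ∀ {p} → Prime p → ∀ k → k < p → ¬ p ∣ k !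
prime∤! {p} pp zero    _   p∣1 = ℕ.nonTrivial⇒≢1 {{prime⇒nonTrivial pp}} (∣1⇒≡1 p∣1)
prime∤! {p} pp (suc k) k<p p∣k! with euclidsLemma (suc k) (k !) pp p∣k!
... | inj₁ p∣1+k = ℕ.<⇒≱ k<p (∣⇒≤ p∣1+k)
... | inj₂ p∣k!′ = prime∤! pp k (ℕ.<-trans (ℕ.n<1+n k) k<p) p∣k!′

-- `p` divides p! = (p C k) · k! · (p - k)!, but neither factorial, since both `k` and `p ∸ k` are
-- below `p`.
prime∣binomial : ∀ {p} → Prime p → ∀ {k} → 0 < k → k < p → p ∣ p C k
prime∣binomial {p@(suc p′)} pp {k} 0<k k<p =
  [ (λ p∣C → p∣C)
  , (λ p∣k![p∸k]! → ⊥-elim ([ prime∤! pp k k<p , prime∤! pp (p ∸ k) (ℕ.∸-monoʳ-< 0<k (ℕ.<⇒≤ k<p)) ]′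
                              (euclidsLemma (k !) ((p ∸ k) !) pp p∣k![p∸k]!)))
  ]′ (euclidsLemma (p C k) (k ! ℕ.* (p ∸ k) !) pp (≡.subst (p ∣_) (≡.sym C*k!*[p∸k]!≡p!) (m∣m*n (p′ !))))
  where
  instance _ = k ℕ.!* (p ∸ k) !≢0
  C*k!*[p∸k]!≡p! : (p C k) ℕ.* (k ! ℕ.* (p ∸ k) !) ≡ p !
  C*k!*[p∸k]!≡p! = ≡.trans
    (≡.cong (ℕ._* (k ! ℕ.* (p ∸ k) !)) (nCk≡n!/k![n-k]! (ℕ.<⇒≤ k<p)))
    (m/n*n≡m (k![n∸k]!∣n! (ℕ.<⇒≤ k<p)))

primePower>1 : ∀ {q} → IsPrimePower q → 1 < q
primePower>1 (p , k , pp , 1≤k , ≡.refl) = ℕ.<-≤-trans (ℕ.nonTrivial⇒n>1 p {{prime⇒nonTrivial pp}})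
  (≡.subst (_≤ p ℕ.^ k) (ℕ.^-identityʳ p) (ℕ.^-monoʳ-≤ p {{prime⇒nonZero pp}} 1≤k))

n<m^n : ∀ {m} → 1 < m → ∀ n → n < m ℕ.^ n
n<m^n 1<m zero    = s≤s z≤n
n<m^n 1<m (suc n) = ℕ.≤-<-trans (n<m^n 1<m n) (ℕ.^-monoʳ-< _ 1<m (ℕ.n<1+n n))

^-cancelʳ-≤ : ∀ {m} → 1 < m → ∀ {i j} → m ℕ.^ i ≤ m ℕ.^ j → i ≤ j
^-cancelʳ-≤ 1<m mⁱ≤mʲ = ℕ.≮⇒≥ λ j<i → ℕ.<⇒≱ (ℕ.^-monoʳ-< _ 1<m j<i) mⁱ≤mʲ

-- Search, counting and permutations in finite setoids.

module FiniteSetoid {a ℓ m} (S : Setoid a ℓ) (order : HasOrder S m) where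
  open Setoid S renaming (Carrier to A)
  open Bijection order using (injective; surjective)

  element : Fin m → A
  element = Bijection.to order

  index : A → Fin m
  index x = proj₁ (surjective x)

  element-index : ∀ x → element (index x) ≈ x
  element-index x = proj₂ (surjective x) ≡.refl

  index-injective : ∀ {x y} → index x ≡ index y → x ≈ y
  index-injective {x} {y} eq =
    trans (sym (element-index x)) (trans (reflexive (≡.cong element eq)) (element-index y))

  infix 4 _≟_
  _≟_ : ∀ x y → Dec (x ≈ y)
  x ≟ y with index x Fin.≟ index y
  ... | yes eq = yes (index-injective eq)
  ... | no neq = no λ x≈y →
    neq (injective (trans (element-index x) (trans x≈y (sym (element-index y)))))

  any? : ∀ {p} {P : Pred A p} → P Respects _≈_ → Decidable P → Dec (∃ P)
  any? resp P? = map′ (λ (i , Pi) → element i , Pi)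
    (λ (x , Px) → index x , resp (sym (element-index x)) Px) (Fin.any? (P? ∘ element))

  injective⇒≤ : ∀ {k} (g : Fin k → A) → (∀ {i j} → g i ≈ g j → i ≡ j) → k ≤ m
  injective⇒≤ g inj = Fin.injective⇒≤ {f = index ∘ g} (inj ∘ index-injective)

  -- `g` and `h` are inverse only up to `≈`; transporting them to `Fin m` along `index` and
  -- `element` gives a genuine permutation, under which finite sums and products are invariant.
  permute : (g h : A → A) → (∀ {x y} → x ≈ y → g x ≈ g y) → (∀ {x y} → x ≈ y → h x ≈ h y) →
            (∀ x → g (h x) ≈ x) → (∀ x → h (g x) ≈ x) →
            Σ[ π ∈ Permutation′ m ] (∀ i → element (π ⟨$⟩ʳ i) ≈ g (element i))
  permute g h g-cong h-cong g∘h h∘g =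
    permutation (index ∘ g ∘ element) (index ∘ h ∘ element)
      (inverse g h g-cong g∘h) (inverse h g h-cong h∘g) ,
    λ i → element-index (g (element i))
    where
    inverse : ∀ g h → (∀ {x y} → x ≈ y → g x ≈ g y) → (∀ x → g (h x) ≈ x) →
              ∀ i → index (g (element (index (h (element i))))) ≡ i
    inverse g h g-cong g∘h i = injective (trans (element-index _)
      (trans (g-cong (element-index _)) (g∘h _)))

-- Division and cancellation in a field.

module FieldProperties {c ℓ} (K : Field c ℓ) where
  open Field K hiding (zero)
  open SetoidReasoning setoid

  ⁻¹-inverseˡ : ∀ x → x ⁻¹ * proj₁ x ≈ 1#
  ⁻¹-inverseˡ (x , x≉0) = proj₁ (proj₂ (invertible x x≉0))

  ⁻¹-inverseʳ : ∀ x → proj₁ x * x ⁻¹ ≈ 1#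
  ⁻¹-inverseʳ (x , x≉0) = proj₂ (proj₂ (invertible x x≉0))

  /-*-cancel : ∀ x y → (x / y) * proj₁ y ≈ x
  /-*-cancel x y = begin
    (x * y ⁻¹) * proj₁ y ≈⟨ *-assoc _ _ _ ⟩
    x * (y ⁻¹ * proj₁ y) ≈⟨ *-congˡ (⁻¹-inverseˡ y) ⟩
    x * 1#               ≈⟨ *-identityʳ x ⟩
    x                    ∎

  *-/-cancel : ∀ x y → (x * proj₁ y) / y ≈ x
  *-/-cancel x y = begin
    (x * proj₁ y) * y ⁻¹ ≈⟨ *-assoc _ _ _ ⟩
    x * (proj₁ y * y ⁻¹) ≈⟨ *-congˡ (⁻¹-inverseʳ y) ⟩
    x * 1#               ≈⟨ *-identityʳ x ⟩
    x                    ∎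

  *-cancelʳ-nonZero : ∀ x y z → ¬ (z ≈ 0#) → x * z ≈ y * z → x ≈ y
  *-cancelʳ-nonZero x y z z≉0 xz≈yz = begin
    x                  ≈⟨ *-/-cancel x (z , z≉0) ⟨
    (x * z) / (z , z≉0) ≈⟨ *-congʳ xz≈yz ⟩
    (y * z) / (z , z≉0) ≈⟨ *-/-cancel y (z , z≉0) ⟩
    y                  ∎

  *-nonZero : ∀ {x y} → ¬ (x ≈ 0#) → ¬ (y ≈ 0#) → ¬ (x * y ≈ 0#)
  *-nonZero {x} {y} x≉0 y≉0 xy≈0 =
    x≉0 (*-cancelʳ-nonZero x 0# y y≉0 (trans xy≈0 (sym (zeroˡ y))))

  cross-multiply : ∀ x y w z → x * proj₁ z ≈ w * proj₁ y → x / y ≈ w / z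
  cross-multiply x (y , y≉0) w (z , z≉0) xz≈wy =
    *-cancelʳ-nonZero _ _ (y * z) (*-nonZero y≉0 z≉0) (begin
    x / (y , y≉0) * (y * z)    ≈⟨ *-assoc _ y z ⟨
    x / (y , y≉0) * y * z      ≈⟨ *-congʳ (/-*-cancel x (y , y≉0)) ⟩
    x * z                      ≈⟨ xz≈wy ⟩
    w * y                      ≈⟨ *-congʳ (/-*-cancel w (z , z≉0)) ⟨
    w / (z , z≉0) * z * y      ≈⟨ *-assoc _ z y ⟩
    w / (z , z≉0) * (z * y)    ≈⟨ *-congˡ (*-comm z y) ⟩
    w / (z , z≉0) * (y * z)    ∎)

-- Additivity of the Frobenius map in characteristic p.

module FrobeniusProperties {c ℓ} (K : Field c ℓ) {p} (pp : Prime p) where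
  open Field K hiding (zero)
  open SetoidReasoning setoid
  open CommutativeSemiringExp commutativeSemiring using (^-congˡ; ^-assocʳ) renaming (_^_ to _^ᴷ_)
  open SemiringMult semiring using (×-congʳ; ×-assoc-*; ×-homo-1; ×1-homo-*) renaming (_×_ to _×ᴷ_)
  open SemiringSum semiring using (sum; sum-init-last; sum-cong-≋; sum-replicate-zero)

  module _ (p×1≈0 : p ×ᴷ 1# ≈ 0#) where

    multiple×≈0 : ∀ {m} → p ∣ m → ∀ x → m ×ᴷ x ≈ 0#
    multiple×≈0 (divides-refl k) x = begin
      (k ℕ.* p) ×ᴷ x                 ≈⟨ ×-congʳ (k ℕ.* p) (*-identityˡ x) ⟨
      (k ℕ.* p) ×ᴷ (1# * x)         ≈⟨ ×-assoc-* (k ℕ.* p) 1# x ⟨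
      ((k ℕ.* p) ×ᴷ 1#) * x         ≈⟨ *-congʳ (×1-homo-* k p) ⟩
      ((k ×ᴷ 1#) * (p ×ᴷ 1#)) * x ≈⟨ *-congʳ (*-congˡ p×1≈0) ⟩
      ((k ×ᴷ 1#) * 0#) * x       ≈⟨ *-congʳ (zeroʳ _) ⟩
      0# * x                      ≈⟨ zeroˡ x ⟩
      0#                           ∎

    ^p-distrib-+ : ∀ x y → (x + y) ^ᴷ p ≈ x ^ᴷ p + y ^ᴷ p
    ^p-distrib-+ x y = helper p ≡.refl
      where
      open Binomial commutativeSemiring using (theorem; binomialTerm)
      -- The exponent is generalised to `m` so that it can be split as `suc k`, the shape in which
      -- the two extreme terms separate from the binomial sum; the terms in between vanish.
      helper : ∀ m → m ≡ p → (x + y) ^ᴷ m ≈ x ^ᴷ m + y ^ᴷ m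
      helper zero      0≡p     = contradiction (≡.sym 0≡p) (ℕ.≢-nonZero⁻¹ p {{prime⇒nonZero pp}})
      helper m@(suc k) ≡.refl = begin
        (x + y) ^ᴷ m                                                  ≈⟨ theorem m x y ⟩
        term zero + sum (λ i → term (suc i))                          ≈⟨ +-congˡ (sum-init-last (λ i → term (suc i))) ⟩
        term zero + (sum (λ i → term (suc (inject₁ i))) + term (suc (fromℕ k)))
                                                                      ≈⟨ +-cong first (+-cong (trans (sum-cong-≋ middle) (sum-replicate-zero k)) last) ⟩
        y ^ᴷ m + (0# + x ^ᴷ m)                                        ≈⟨ +-congˡ (+-identityˡ _) ⟩
        y ^ᴷ m + x ^ᴷ m                                               ≈⟨ +-comm _ _ ⟩
        x ^ᴷ m + y ^ᴷ m                                               ∎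
        where
        term : Fin (suc m) → Carrier
        term = binomialTerm x y m

        first : term zero ≈ y ^ᴷ m
        first = trans (×-homo-1 _) (*-identityˡ _)

        middle : ∀ i → term (suc (inject₁ i)) ≈ 0#
        middle i = multiple×≈0 (prime∣binomial pp (s≤s z≤n)
          (s≤s (≡.subst (_< k) (≡.sym (Fin.toℕ-inject₁ i)) (Fin.toℕ<n i)))) _

        last : term (suc (fromℕ k)) ≈ x ^ᴷ m
        last rewrite Fin.toℕ-fromℕ k | nCn≡1 m | ℕ.n∸n≡0 k = trans (×-homo-1 _) (*-identityʳ _)

    ^pʲ-distrib-+ : ∀ j x y → (x + y) ^ᴷ (p ℕ.^ j) ≈ x ^ᴷ (p ℕ.^ j) + y ^ᴷ (p ℕ.^ j)
    ^pʲ-distrib-+ zero    x y = trans (*-identityʳ _) (sym (+-cong (*-identityʳ x) (*-identityʳ y)))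
    ^pʲ-distrib-+ (suc j) x y = begin
      (x + y) ^ᴷ (p ℕ.* p ℕ.^ j)                      ≈⟨ ^-assocʳ (x + y) p _ ⟨
      ((x + y) ^ᴷ p) ^ᴷ (p ℕ.^ j)                     ≈⟨ ^-congˡ (p ℕ.^ j) (^p-distrib-+ x y) ⟩
      (x ^ᴷ p + y ^ᴷ p) ^ᴷ (p ℕ.^ j)                  ≈⟨ ^pʲ-distrib-+ j _ _ ⟩
      (x ^ᴷ p) ^ᴷ (p ℕ.^ j) + (y ^ᴷ p) ^ᴷ (p ℕ.^ j)   ≈⟨ +-cong (^-assocʳ x p _) (^-assocʳ y p _) ⟩
      x ^ᴷ (p ℕ.* p ℕ.^ j) + y ^ᴷ (p ℕ.* p ℕ.^ j)     ∎

-- Characteristic of a finite field, and Fermat's theorem on a subfield.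

module FiniteField {c ℓ} (K : Field c ℓ) {N} (order : HasOrder (Field.setoid K) N) where
  open Field K hiding (zero)
  open FieldProperties K
  open SetoidReasoning setoid
  open FiniteSetoid setoid order
  open GroupProperties +-group using (identityʳ-unique; //-rightDividesˡ; //-rightDividesʳ)
  open CommutativeSemiringExp commutativeSemiring using () renaming (_^_ to _^ᴷ_)
  open SemiringMult semiring using (×1-homo-*) renaming (_×_ to _×ᴷ_)

  -- Translation by 1# permutes the elements of K, so it preserves their sum.
  order×1≈0 : N ×ᴷ 1# ≈ 0#
  order×1≈0 with permute (_+ 1#) (_- 1#) +-congʳ +-congʳ (//-rightDividesˡ 1#) (//-rightDividesʳ 1#)
  ... | π , element-π = identityʳ-unique (sum element) (N ×ᴷ 1#) (begin
    sum element + N ×ᴷ 1#             ≈⟨ +-congˡ (sum-replicate N) ⟨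
    sum element + sum {N} (λ _ → 1#)  ≈⟨ ∑-distrib-+ element (λ _ → 1#) ⟨
    sum (λ i → element i + 1#)        ≈⟨ sum-cong-≋ element-π ⟨
    sum (λ i → element (π ⟨$⟩ʳ i))    ≈⟨ sum-permute element π ⟨
    sum element                       ∎)
    where open CommutativeMonoidSum +-commutativeMonoid

  -- `order×1≈0` kills only the full order, a power of the prime. Multiples of `1#` multiply like
  -- their multipliers and a field has no zero divisors, so one factor `p ×ᴷ 1#` already vanishes;
  -- exponent 0 would give 1 = 0.
  p^j×1≈0⇒p×1≈0 : ∀ p j → (p ℕ.^ j) ×ᴷ 1# ≈ 0# → p ×ᴷ 1# ≈ 0#
  p^j×1≈0⇒p×1≈0 p zero    1×1≈0 = contradiction (trans (sym 1×1≈0) (+-identityʳ 1#)) 0≉1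
  p^j×1≈0⇒p×1≈0 p (suc j) p^1+j×1≈0 with p ×ᴷ 1# ≟ 0# | (p ℕ.^ j) ×ᴷ 1# ≟ 0#
  ... | yes p×1≈0 | _           = p×1≈0
  ... | no _      | yes p^j×1≈0 = p^j×1≈0⇒p×1≈0 p j p^j×1≈0
  ... | no p×1≉0  | no p^j×1≉0  =
    contradiction (trans (sym (×1-homo-* p (p ℕ.^ j))) p^1+j×1≈0) (*-nonZero p×1≉0 p^j×1≉0)

  module _ {s} (F : Subfield K s) {q} (F-order : HasOrder (Subfield.subsetoid F) q) where
    open Subfield F
    module F = FiniteSetoid subsetoid F-order
    open CommutativeMonoidSum *-commutativeMonoid
      renaming (sum to product; ∑-distrib-+ to ∏-distrib-*; sum-cong-≋ to product-cong-≋;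
                sum-permute to product-permute; sum-remove to product-remove; sum-replicate to product-replicate)
      using ()

    -- The predicate of a subfield is arbitrary; searching the enumeration of `F` decides it. This
    -- later allows an element outside F_q to be found.
    member? : Decidable ⟦_⟧
    member? x = map′ (λ ((y , y∈F) , y≈x) → resp y≈x y∈F) (λ x∈F → (x , x∈F) , refl)
      (F.any? (λ y≈z y≈x → trans (sym y≈z) y≈x) (λ (y , _) → y ≟ x))

    private
      product-nonZero : ∀ {m} (v : Vector Carrier m) → (∀ i → ¬ (v i ≈ 0#)) → ¬ (product v ≈ 0#)
      product-nonZero {zero}  v v≉0 1≈0 = 0≉1 (sym 1≈0)
      product-nonZero {suc m} v v≉0     = *-nonZero (v≉0 zero) (product-nonZero (v ∘ suc) (v≉0 ∘ suc))

      -- The leading `a` makes up for the factor 1 at `i₀`, so there are `m` factors `a` in all.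
      -- Fermat's theorem thus appears as a^q = a, without the exponent q - 1.
      product-all-but-one : ∀ {m} a (v : Vector Carrier m) i₀ → v i₀ ≈ 1# → (∀ i → i ≢ i₀ → v i ≈ a) →
                            a * product v ≈ a ^ᴷ m
      product-all-but-one {suc m} a v i₀ vi₀≈1 v≈a = *-congˡ (begin
        product v                                  ≈⟨ product-remove {i = i₀} v ⟩
        v i₀ * product (λ j → v (punchIn i₀ j))    ≈⟨ *-cong vi₀≈1 (product-cong-≋ λ j → v≈a _ (Fin.punchInᵢ≢i i₀ j)) ⟩
        1# * product {m} (λ _ → a)                 ≈⟨ *-identityˡ _ ⟩
        product {m} (λ _ → a)                      ≈⟨ product-replicate m ⟩
        a ^ᴷ m                                     ∎)

      infix 6 _unless0_
      -- Putting 1 in place of the factor at zero turns a product over the nonzero elements of `F`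
      -- into a product over all of `Fin q`, so the units need no enumeration of their own.
      _unless0_ : Carrier → Carrier → Carrier
      a unless0 x = if does (x ≟ 0#) then 1# else a

      unless0-zero : ∀ {a x} → x ≈ 0# → a unless0 x ≈ 1#
      unless0-zero {x = x} x≈0 with x ≟ 0#
      ... | yes _  = refl
      ... | no x≉0 = contradiction x≈0 x≉0

      unless0-nonZero : ∀ {a x} → ¬ (x ≈ 0#) → a unless0 x ≈ a
      unless0-nonZero {x = x} x≉0 with x ≟ 0#
      ... | yes x≈0 = contradiction x≈0 x≉0
      ... | no _    = refl

      self-unless0-≉0 : ∀ x → ¬ (x unless0 x ≈ 0#)
      self-unless0-≉0 x with x ≟ 0#
      ... | yes _  = 0≉1 ∘ sym
      ... | no x≉0 = x≉0

      self-unless0-cong : ∀ {x y} → x ≈ y → x unless0 x ≈ y unless0 y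
      self-unless0-cong {x} {y} x≈y with y ≟ 0#
      ... | yes y≈0 = unless0-zero (trans x≈y y≈0)
      ... | no y≉0  = trans (unless0-nonZero (y≉0 ∘ trans (sym x≈y))) x≈y

      self-unless0-* : ∀ a x → ¬ (a ≈ 0#) → (a * x) unless0 (a * x) ≈ (a unless0 x) * (x unless0 x)
      self-unless0-* a x a≉0 with x ≟ 0#
      ... | yes x≈0 = trans (unless0-zero (trans (*-congˡ x≈0) (zeroʳ a))) (sym (*-identityˡ 1#))
      ... | no x≉0  = unless0-nonZero (*-nonZero a≉0 x≉0)

    private
      x : Fin q → Carrier
      x = proj₁ ∘ F.element

      scale : (a : Carrier*) → proj₁ a ∈ ⟦_⟧ →
              Σ[ π ∈ Permutation′ q ] (∀ i → x (π ⟨$⟩ʳ i) ≈ proj₁ a * x i)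
      scale a a∈F = F.permute
        (λ (y , y∈F) → proj₁ a * y , *-closed a∈F y∈F)
        (λ (y , y∈F) → a ⁻¹ * y , *-closed (⁻¹-closed a a∈F) y∈F)
        *-congˡ *-congˡ
        (λ (y , _) → cancel (⁻¹-inverseʳ a) y)
        (λ (y , _) → cancel (⁻¹-inverseˡ a) y)
        where
        cancel : ∀ {u v} → u * v ≈ 1# → ∀ y → u * (v * y) ≈ y
        cancel uv≈1 y = trans (sym (*-assoc _ _ _)) (trans (*-congʳ uv≈1) (*-identityˡ y))

      -- Multiplication by a permutes F, so it preserves the product of the nonzero elements of F.
      product-unless0≈1 : (a : Carrier*) → proj₁ a ∈ ⟦_⟧ → product (λ i → proj₁ a unless0 x i) ≈ 1#
      product-unless0≈1 (a , a≉0) a∈F = *-cancelʳ-nonZero _ _ (product (λ i → x i unless0 x i))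
        (product-nonZero _ λ i → self-unless0-≉0 (x i)) (begin
        product (λ i → a unless0 x i) * product (λ i → x i unless0 x i)   ≈⟨ ∏-distrib-* (λ i → a unless0 x i) (λ i → x i unless0 x i) ⟨
        product (λ i → (a unless0 x i) * (x i unless0 x i))               ≈⟨ product-cong-≋ (λ i → self-unless0-* a (x i) a≉0) ⟨
        product (λ i → (a * x i) unless0 (a * x i))                       ≈⟨ product-cong-≋ (λ i → self-unless0-cong (proj₂ scaled i)) ⟨
        product (λ i → x (π ⟨$⟩ʳ i) unless0 x (π ⟨$⟩ʳ i))                 ≈⟨ product-permute (λ i → x i unless0 x i) π ⟨
        product (λ i → x i unless0 x i)                                   ≈⟨ *-identityˡ _ ⟨
        1# * product (λ i → x i unless0 x i)                              ∎)
        where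
        scaled = scale (a , a≉0) a∈F
        π = proj₁ scaled

      fermat-nonZero : (a : Carrier*) → proj₁ a ∈ ⟦_⟧ → proj₁ a ^ᴷ q ≈ proj₁ a
      fermat-nonZero (a , a≉0) a∈F = begin
        a ^ᴷ q                             ≈⟨ product-all-but-one a (λ i → a unless0 x i) i₀ (unless0-zero x₀≈0) others ⟨
        a * product (λ i → a unless0 x i)  ≈⟨ *-congˡ (product-unless0≈1 (a , a≉0) a∈F) ⟩
        a * 1#                             ≈⟨ *-identityʳ a ⟩
        a                                  ∎
        where
        i₀ : Fin q
        i₀ = F.index (0# , 0-closed)

        x₀≈0 : x i₀ ≈ 0#
        x₀≈0 = F.element-index (0# , 0-closed)

        others : ∀ i → i ≢ i₀ → a unless0 x i ≈ a
        others i i≢i₀ = unless0-nonZero λ xi≈0 →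
          i≢i₀ (Bijection.injective F-order (trans xi≈0 (sym x₀≈0)))

      -- The argument in `Fin m` witnesses that `m` is positive; with exponent 0 the power would be
      -- 1.
      fermat-zero : ∀ {a m} → Fin m → a ≈ 0# → a ^ᴷ m ≈ a
      fermat-zero {m = suc m} _ a≈0 = trans (trans (*-congʳ a≈0) (zeroˡ _)) (sym a≈0)

    fermat : ∀ a → a ∈ ⟦_⟧ → a ^ᴷ q ≈ a
    fermat a a∈F with a ≟ 0#
    ... | yes a≈0 = fermat-zero (F.index (a , a∈F)) a≈0
    ... | no a≉0  = fermat-nonZero (a , a≉0) a∈F

-- Enumeration of spans and existence of bases over a finite subfield.

module FiniteSpan {c ℓ s v ℓv} (K : Field c ℓ) (F : Subfield K s) {q}
                  (F-order : HasOrder (Subfield.subsetoid F) q)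
                  (V : Module (Field.commutativeRing K) v ℓv) where
  open Field K hiding (zero)
  open Subfield F
  open Module V
  open SetoidReasoning ≈ᴹ-setoid
  open FieldProperties K
  open GroupProperties +-group using (∙-cancelʳ; //-rightDividesˡ)
  open GroupProperties +ᴹ-group using () renaming (identityˡ-unique to +ᴹ-identityˡ-unique; ∙-cancelʳ to +ᴹ-cancelʳ)
  open CommutativeMonoidSum +ᴹ-commutativeMonoid using (sum-cong-≋; ∑-distrib-+)
  private module F = FiniteSetoid subsetoid F-order

  lin : ∀ {d} → Vector Carrier d → Vector Carrierᴹ d → Carrierᴹ
  lin = combination K F V

  lin-cong : ∀ {d} {a a′ : Vector Carrier d} (b : Vector Carrierᴹ d) →
             (∀ i → a i ≈ a′ i) → lin a b ≈ᴹ lin a′ b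
  lin-cong b a≈a′ = sum-cong-≋ λ i → *ₗ-congʳ (a≈a′ i)

  lin-+ : ∀ {d} (a a′ : Vector Carrier d) b → lin (λ i → a i + a′ i) b ≈ᴹ lin a b +ᴹ lin a′ b
  lin-+ a a′ b = ≈ᴹ-trans (sum-cong-≋ λ i → *ₗ-distribʳ (b i) (a i) (a′ i)) (∑-distrib-+ (λ i → a i *ₗ b i) (λ i → a′ i *ₗ b i))

  lin-* : ∀ {d} k (a : Vector Carrier d) b → lin (λ i → k * a i) b ≈ᴹ k *ₗ lin a b
  lin-* {zero}  k a b = ≈ᴹ-sym (*ₗ-zeroʳ k)
  lin-* {suc d} k a b = ≈ᴹ-trans
    (+ᴹ-cong (*ₗ-assoc k (a zero) (b zero)) (lin-* k (a ∘ suc) (b ∘ suc)))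
    (≈ᴹ-sym (*ₗ-distribˡ k _ _))

  record IsSubspace {u} (U : Pred Carrierᴹ u) : Set (c ⊔ s ⊔ v ⊔ ℓv ⊔ u) where
    field
      U-resp     : U Respects _≈ᴹ_
      0ᴹ-closed  : 0ᴹ ∈ U
      +ᴹ-closed  : ∀ {x y} → x ∈ U → y ∈ U → (x +ᴹ y) ∈ U
      *ₗ-closed  : ∀ {a x} → a ∈ ⟦_⟧ → x ∈ U → (a *ₗ x) ∈ U

    lin-closed : ∀ {d} {a : Vector Carrier d} {b} → (∀ i → a i ∈ ⟦_⟧) → (∀ i → b i ∈ U) → lin a b ∈ U
    lin-closed {zero}  a∈F b∈U = 0ᴹ-closed
    lin-closed {suc d} a∈F b∈U =
      +ᴹ-closed (*ₗ-closed (a∈F zero) (b∈U zero)) (lin-closed (a∈F ∘ suc) (b∈U ∘ suc))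

  -- `finToFun` reads `k` as `d` digits in base `q`, so tuples over `F` are indexed by
  -- `Fin (q ^ d)`. This is the source of the powers of q compared in both bounds.
  coefficients : ∀ d → Fin (q ℕ.^ d) → Vector Carrier d
  coefficients d k i = proj₁ (F.element (finToFun {q} {d} k i))

  coefficients∈F : ∀ d (k : Fin (q ℕ.^ d)) i → coefficients d k i ∈ ⟦_⟧
  coefficients∈F d k i = proj₂ (F.element (finToFun {q} {d} k i))

  coefficients-surjective : ∀ {d} (a : Vector Carrier d) → (∀ i → a i ∈ ⟦_⟧) →
                            ∃[ k ] (∀ i → coefficients d k i ≈ a i)
  coefficients-surjective a a∈F = funToFin α , λ i → trans
    (reflexive (≡.cong (proj₁ ∘ F.element) (Fin.finToFun-funToFin α i)))
    (F.element-index (a i , a∈F i))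
    where α = λ i → F.index (a i , a∈F i)

  funToFin-cong : ∀ {m d} {α β : Fin d → Fin m} → (∀ i → α i ≡ β i) → funToFin α ≡ funToFin β
  funToFin-cong {d = zero}  α≗β = ≡.refl
  funToFin-cong {d = suc d} α≗β = ≡.cong₂ combine (α≗β zero) (funToFin-cong (α≗β ∘ suc))

  coefficients-injective : ∀ d {k k′ : Fin (q ℕ.^ d)} →
                           (∀ i → coefficients d k i ≈ coefficients d k′ i) → k ≡ k′
  coefficients-injective d {k} {k′} eq = ≡.trans (≡.sym (Fin.funToFin-finToFin {d} {q} k))
    (≡.trans (funToFin-cong {q} {d} (λ i → Bijection.injective F-order (eq i))) (Fin.funToFin-finToFin {d} {q} k′))

  enumerate : ∀ {d} → Vector Carrierᴹ d → Fin (q ℕ.^ d) → Carrierᴹ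
  enumerate {d} b k = lin (coefficients d k) b

  enumerate-injective : ∀ {d} {b : Vector Carrierᴹ d} → LinearlyIndependent K F V b →
                        ∀ {k k′} → enumerate b k ≈ᴹ enumerate b k′ → k ≡ k′
  enumerate-injective {d} {b} indep {k} {k′} eq = coefficients-injective d λ i →
    ∙-cancelʳ (- a′ i) _ _ (trans (indep (λ i → a i - a′ i) a-a′∈F lin≈0 i) (sym (-‿inverseʳ _)))
    where
    a = coefficients d k
    a′ = coefficients d k′

    a-a′∈F : ∀ i → (a i - a′ i) ∈ ⟦_⟧
    a-a′∈F i = +-closed (coefficients∈F d k i) (neg-closed (coefficients∈F d k′ i))

    lin≈0 : lin (λ i → a i - a′ i) b ≈ᴹ 0ᴹ
    lin≈0 = +ᴹ-identityˡ-unique _ (lin a′ b) (begin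
      lin (λ i → a i - a′ i) b +ᴹ lin a′ b  ≈⟨ lin-+ (λ i → a i - a′ i) a′ b ⟨
      lin (λ i → a i - a′ i + a′ i) b       ≈⟨ lin-cong b (λ i → //-rightDividesˡ (a′ i) (a i)) ⟩
      lin a b                               ≈⟨ eq ⟩
      lin a′ b                              ∎)

  -- Otherwise the coefficients 1, 0, ..., 0 would form a nontrivial relation.
  independent⇒head≉0 : ∀ {d} {b : Vector Carrierᴹ (suc d)} → LinearlyIndependent K F V b → ¬ (b zero ≈ᴹ 0ᴹ)
  independent⇒head≉0 {d} {b} indep b₀≈0 = 0≉1 (sym (indep a a∈F (begin
    1# *ₗ b zero +ᴹ lin (λ _ → 0#) (b ∘ suc)  ≈⟨ +ᴹ-cong (≈ᴹ-trans (*ₗ-congˡ b₀≈0) (*ₗ-zeroʳ 1#)) tail≈0 ⟩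
    0ᴹ +ᴹ 0ᴹ                                  ≈⟨ +ᴹ-identityˡ 0ᴹ ⟩
    0ᴹ                                        ∎) zero))
    where
    a : Vector Carrier (suc d)
    a = 1# ∷ λ _ → 0#

    a∈F : ∀ i → a i ∈ ⟦_⟧
    a∈F zero    = 1-closed
    a∈F (suc _) = 0-closed

    tail≈0 : lin (λ _ → 0#) (b ∘ suc) ≈ᴹ 0ᴹ
    tail≈0 = begin
      lin (λ _ → 0#) (b ∘ suc)       ≈⟨ lin-cong (b ∘ suc) (λ _ → zeroˡ 0#) ⟨
      lin (λ _ → 0# * 0#) (b ∘ suc)  ≈⟨ lin-* 0# (λ _ → 0#) (b ∘ suc) ⟩
      0# *ₗ lin (λ _ → 0#) (b ∘ suc) ≈⟨ *ₗ-zeroˡ _ ⟩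
      0ᴹ                             ∎

  module _ (_≟_ : ∀ x y → Dec (x ≈ y)) (_≟ᴹ_ : ∀ u w → Dec (u ≈ᴹ w)) where

    Span? : ∀ {d} (b : Vector Carrierᴹ d) → Decidable (Span K F V b)
    Span? {d} b u = map′
      (λ (k , u≈) → coefficients d k , coefficients∈F d k , u≈)
      (λ (a , a∈F , u≈) → let (k , k≈a) = coefficients-surjective a a∈F in
        k , ≈ᴹ-trans u≈ (≈ᴹ-sym (lin-cong b k≈a)))
      (Fin.any? λ k → u ≟ᴹ enumerate b k)

    -- In a relation on `u ∷ b`, a nonzero coefficient of `u` could be inverted in `F`, which would
    -- express `u` through `b`; so it is zero and the relation is one on `b`.
    ∷-independent : ∀ {d u} {b : Vector Carrierᴹ d} → LinearlyIndependent K F V b →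
                    u ∉ Span K F V b → LinearlyIndependent K F V (u ∷ b)
    ∷-independent {d} {u} {b} indep u∉Span a a∈F lin≈0 = zeros (a zero ≟ 0#)
      where
      L = lin (a ∘ suc) b

      zeros : Dec (a zero ≈ 0#) → ∀ i → a i ≈ 0#
      zeros (yes a₀≈0) zero    = a₀≈0
      zeros (yes a₀≈0) (suc i) = indep (a ∘ suc) (a∈F ∘ suc) (begin
        L                   ≈⟨ +ᴹ-identityˡ L ⟨
        0ᴹ +ᴹ L             ≈⟨ +ᴹ-congʳ (≈ᴹ-trans (*ₗ-congʳ a₀≈0) (*ₗ-zeroˡ u)) ⟨
        a zero *ₗ u +ᴹ L    ≈⟨ lin≈0 ⟩
        0ᴹ                  ∎) i
      zeros (no a₀≉0) = contradiction
        ((λ i → - k * a (suc i)) , (λ i → *-closed (neg-closed k∈F) (a∈F (suc i))) ,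
         ≈ᴹ-trans u≈-kL (≈ᴹ-sym (lin-* (- k) (a ∘ suc) b)))
        u∉Span
        where
        a₀ = a zero , a₀≉0
        k = a₀ ⁻¹

        k∈F : k ∈ ⟦_⟧
        k∈F = ⁻¹-closed a₀ (a∈F zero)

        u≈-kL : u ≈ᴹ - k *ₗ L
        u≈-kL = +ᴹ-cancelʳ (k *ₗ L) _ _ (begin
          u +ᴹ k *ₗ L                    ≈⟨ +ᴹ-congʳ (*ₗ-identityˡ u) ⟨
          1# *ₗ u +ᴹ k *ₗ L              ≈⟨ +ᴹ-congʳ (*ₗ-congʳ (⁻¹-inverseˡ a₀)) ⟨
          (k * a zero) *ₗ u +ᴹ k *ₗ L    ≈⟨ +ᴹ-congʳ (*ₗ-assoc k (a zero) u) ⟩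
          k *ₗ a zero *ₗ u +ᴹ k *ₗ L     ≈⟨ *ₗ-distribˡ k _ L ⟨
          k *ₗ (a zero *ₗ u +ᴹ L)        ≈⟨ *ₗ-congˡ lin≈0 ⟩
          k *ₗ 0ᴹ                        ≈⟨ *ₗ-zeroʳ k ⟩
          0ᴹ                             ≈⟨ *ₗ-zeroˡ L ⟨
          0# *ₗ L                        ≈⟨ *ₗ-congʳ (-‿inverseˡ k) ⟨
          (- k + k) *ₗ L                 ≈⟨ *ₗ-distribʳ L (- k) k ⟩
          - k *ₗ L +ᴹ k *ₗ L             ∎)

    module _ {u} {U : Pred Carrierᴹ u} (U-subspace : IsSubspace U) (1<q : 1 < q)
             {N} (e : Fin N → Carrierᴹ) (e∈?U : ∀ i → Dec (e i ∈ U))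
             (e-covers : ∀ {x} → x ∈ U → ∃[ i ] x ≈ᴹ e i) where
      open IsSubspace U-subspace

      -- The q^d combinations are distinct and lie in `U`, so they occur at distinct places among
      -- the `N` listed vectors, and d < q^d ≤ N. The bound is crude but makes the extension below
      -- terminate.
      independent⇒< : ∀ {d} {b : Vector Carrierᴹ d} → (∀ i → b i ∈ U) →
                      LinearlyIndependent K F V b → d < N
      independent⇒< {d} {b} b∈U indep = ℕ.<-≤-trans (n<m^n 1<q d)
        (Fin.injective⇒≤ {f = proj₁ ∘ cover} λ {k} {k′} eq → enumerate-injective indep
          (≈ᴹ-trans (proj₂ (cover k)) (≈ᴹ-trans (≈ᴹ-reflexive (≡.cong e eq)) (≈ᴹ-sym (proj₂ (cover k′))))))
        where
        cover : ∀ k → ∃[ i ] enumerate b k ≈ᴹ e i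
        cover k = e-covers (lin-closed (coefficients∈F d k) b∈U)

      private
        -- Each round adjoins some `e i` in `U` outside the span and trades one unit of fuel for one
        -- vector, keeping `N ≤ fuel + d`. Fuel 0 with a vector still to adjoin would contradict
        -- `d < N`. With none to adjoin, the span contains all of `U`, because `e` covers `U`.
        extend : ∀ fuel {d} → N ≤ fuel ℕ.+ d → (b : Vector Carrierᴹ d) → (∀ i → b i ∈ U) →
                 LinearlyIndependent K F V b → ∃[ w ] Σ[ b ∈ Vector Carrierᴹ w ] (IsBasis K F V U b × (∀ i → b i ∈ U))
        extend fuel N≤ b b∈U indep with Fin.any? (λ i → e∈?U i ×-dec ¬? (Span? b (e i)))
        extend zero N≤ b b∈U indep | yes _ = contradiction N≤ (ℕ.<⇒≱ (independent⇒< b∈U indep))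
        extend (suc fuel) {d} N≤ b b∈U indep | yes (i , eᵢ∈U , eᵢ∉Span) =
          extend fuel (≡.subst (N ≤_) (≡.sym (ℕ.+-suc fuel d)) N≤) (e i ∷ b)
            (λ { zero → eᵢ∈U ; (suc j) → b∈U j }) (∷-independent indep eᵢ∉Span)
        extend _ {d} _ b b∈U indep | no none = d , b ,
          (indep , U⊆Span , λ (a , a∈F , x≈) → U-resp (≈ᴹ-sym x≈) (lin-closed a∈F b∈U)) , b∈U
          where
          U⊆Span : U ⊆ Span K F V b
          U⊆Span {x} x∈U with e-covers x∈U
          ... | i , x≈eᵢ with Span? b (e i)
          ...   | yes (a , a∈F , eᵢ≈) = a , a∈F , ≈ᴹ-trans x≈eᵢ eᵢ≈
          ...   | no eᵢ∉Span = contradiction (i , U-resp x≈eᵢ x∈U , eᵢ∉Span) none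

      basis : ∃[ w ] Σ[ b ∈ Vector Carrierᴹ w ] (IsBasis K F V U b × (∀ i → b i ∈ U))
      basis = extend N (ℕ.m≤m+n N 0) [] (λ ()) (λ _ _ _ ())

-- The subspace attached to a point, its basis, and the two counting bounds.

module PointWeights {c ℓ s} (q n : ℕ) (q-primePower : IsPrimePower q)
                    (K : Field c ℓ) (K-order : HasOrder (Field.setoid K) (q ℕ.^ n))
                    (Fq : Subfield K s) (Fq-order : HasOrder (Subfield.subsetoid Fq) q)
                    (f : QPolynomials.QPolynomial K q n) where
  open Field K hiding (zero)
  open FieldProperties K
  open Subfield Fq
  open QPolynomials K q n
  open Module K² using (Carrierᴹ; _≈ᴹ_; 0ᴹ; _+ᴹ_; _*ₗ_; ≈ᴹ-sym; ≈ᴹ-trans)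
  open FiniteSetoid setoid K-order
  open FiniteField K K-order using (order×1≈0; p^j×1≈0⇒p×1≈0; fermat)
  open FiniteSpan K Fq Fq-order K²
  open SemiringSum semiring using (sum; sum-cong-≋; ∑-distrib-+; *-distribˡ-sum)
  open SemiringMult semiring using (×-congˡ)
  open CommutativeSemiringExp commutativeSemiring using (^-congˡ; ^-assocʳ; ^-distrib-*) renaming (_^_ to _^ᴷ_)
  open SetoidReasoning setoid

  1<q : 1 < q
  1<q = primePower>1 q-primePower

  ^qⁱ-distrib-+ : ∀ i x y → (x + y) ^ᴷ (q ℕ.^ i) ≈ x ^ᴷ (q ℕ.^ i) + y ^ᴷ (q ℕ.^ i)
  ^qⁱ-distrib-+ i x y =
    let (p , k , pp , _ , q≡pᵏ) = q-primePower
        q^≡ : ∀ j → q ℕ.^ j ≡ p ℕ.^ (k ℕ.* j)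
        q^≡ j = ≡.trans (≡.cong (ℕ._^ j) q≡pᵏ) (ℕ.^-*-assoc p k j)
        p×1≈0 = p^j×1≈0⇒p×1≈0 p (k ℕ.* n) (trans (×-congˡ (≡.sym (q^≡ n))) order×1≈0)
    in ≡.subst (λ m → (x + y) ^ᴷ m ≈ x ^ᴷ m + y ^ᴷ m) (≡.sym (q^≡ i))
         (FrobeniusProperties.^pʲ-distrib-+ K pp p×1≈0 (k ℕ.* i) x y)

  ^qⁱ-fixes : ∀ i {a} → a ∈ ⟦_⟧ → a ^ᴷ (q ℕ.^ i) ≈ a
  ^qⁱ-fixes zero        a∈F = *-identityʳ _
  ^qⁱ-fixes (suc i) {a} a∈F = begin
    a ^ᴷ (q ℕ.* q ℕ.^ i)    ≈⟨ ^-assocʳ a q (q ℕ.^ i) ⟨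
    (a ^ᴷ q) ^ᴷ (q ℕ.^ i)   ≈⟨ ^-congˡ (q ℕ.^ i) (fermat Fq Fq-order a a∈F) ⟩
    a ^ᴷ (q ℕ.^ i)          ≈⟨ ^qⁱ-fixes i a∈F ⟩
    a                       ∎

  eval-cong : ∀ {x y} → x ≈ y → eval f x ≈ eval f y
  eval-cong x≈y = sum-cong-≋ {n} λ i → *-congˡ {f i} (^-congˡ (q ℕ.^ toℕ i) x≈y)

  eval-+ : ∀ x y → eval f (x + y) ≈ eval f x + eval f y
  eval-+ x y = trans
    (sum-cong-≋ λ i → trans (*-congˡ (^qⁱ-distrib-+ (toℕ i) x y)) (distribˡ (f i) _ _))
    (∑-distrib-+ (λ i → f i * x ^ᴷ (q ℕ.^ toℕ i)) (λ i → f i * y ^ᴷ (q ℕ.^ toℕ i)))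

  eval-* : ∀ {a} → a ∈ ⟦_⟧ → ∀ x → eval f (a * x) ≈ a * eval f x
  eval-* {a} a∈F x = trans (sum-cong-≋ term) (sym (*-distribˡ-sum a (λ i → f i * x ^ᴷ (q ℕ.^ toℕ i))))
    where
    open SemiringSolver commutativeSemiring using (solve; _:*_; _:=_)
    term : ∀ i → f i * (a * x) ^ᴷ (q ℕ.^ toℕ i) ≈ a * (f i * x ^ᴷ (q ℕ.^ toℕ i))
    term i = begin
      f i * (a * x) ^ᴷ m       ≈⟨ *-congˡ (^-distrib-* a x m) ⟩
      f i * (a ^ᴷ m * x ^ᴷ m)  ≈⟨ *-congˡ (*-congʳ (^qⁱ-fixes (toℕ i) a∈F)) ⟩
      f i * (a * x ^ᴷ m)       ≈⟨ solve 3 (λ u v w → u :* (v :* w) := v :* (u :* w)) refl (f i) a (x ^ᴷ m) ⟩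
      a * (f i * x ^ᴷ m)       ∎
      where m = q ℕ.^ toℕ i

  eval-0 : eval f 0# ≈ 0#
  eval-0 = trans (eval-cong (sym (zeroˡ 0#))) (trans (eval-* 0-closed 0#) (zeroˡ _))

  module _ (P : Point) where
    private
      U : Pred Carrierᴹ (c ⊔ ℓ)
      U = Graph f ∩ ⟨ P ⟩

      P₁ = proj₁ (proj₁ P)
      P₂ = proj₂ (proj₁ P)

    U-subspace : IsSubspace U
    U-subspace = record
      { U-resp    = λ u≈v ((y , u≈) , (k , u≈′)) → (y , ≈ᴹ-trans (≈ᴹ-sym u≈v) u≈) , (k , ≈ᴹ-trans (≈ᴹ-sym u≈v) u≈′)
      ; 0ᴹ-closed = (0# , refl , sym eval-0) , (0# , sym (zeroˡ P₁) , sym (zeroˡ P₂))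
      ; +ᴹ-closed = λ ((y , u₁≈ , u₂≈) , (k , u₁≈′ , u₂≈′)) ((z , v₁≈ , v₂≈) , (l , v₁≈′ , v₂≈′)) →
          (y + z , +-cong u₁≈ v₁≈ , trans (+-cong u₂≈ v₂≈) (sym (eval-+ y z))) ,
          (k + l , trans (+-cong u₁≈′ v₁≈′) (sym (distribʳ P₁ k l)) , trans (+-cong u₂≈′ v₂≈′) (sym (distribʳ P₂ k l)))
      ; *ₗ-closed = λ {a} a∈F ((y , u₁≈ , u₂≈) , (k , u₁≈′ , u₂≈′)) →
          (a * y , *-congˡ u₁≈ , trans (*-congˡ u₂≈) (sym (eval-* a∈F y))) ,
          (a * k , trans (*-congˡ u₁≈′) (sym (*-assoc a k P₁)) , trans (*-congˡ u₂≈′) (sym (*-assoc a k P₂)))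
      }
    open IsSubspace U-subspace

    -- The candidates are all points of the graph, one for each element of `K`; whether one lies on
    -- the line of `P` is decided by searching for the scalar.
    weight-basis : ∃[ w ] Σ[ b ∈ Vector Carrierᴹ w ] (IsBasis K Fq K² U b × (∀ i → b i ∈ U))
    weight-basis = basis _≟_ (λ u v → (proj₁ u ≟ proj₁ v) ×-dec (proj₂ u ≟ proj₂ v)) U-subspace 1<q
      (λ i → element i , eval f (element i))
      (λ i → map′ ((element i , refl , refl) ,_) proj₂
        (any? (λ k≈l (u₁≈ , u₂≈) → trans u₁≈ (*-congʳ k≈l) , trans u₂≈ (*-congʳ k≈l))
              (λ k → (element i ≟ k * P₁) ×-dec (eval f (element i) ≟ k * P₂))))
      (λ ((y , u₁≈ , u₂≈) , _) → index y ,
        trans u₁≈ (sym (element-index y)) , trans u₂≈ (eval-cong (sym (element-index y))))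

    proj₂≈eval : ∀ {u} → u ∈ U → proj₂ u ≈ eval f (proj₁ u)
    proj₂≈eval ((y , u₁≈ , u₂≈) , _) = trans u₂≈ (eval-cong (sym u₁≈))

    proj₁-injective : ∀ {u v} → u ∈ U → v ∈ U → proj₁ u ≈ proj₁ v → u ≈ᴹ v
    proj₁-injective u∈U v∈U u₁≈v₁ =
      u₁≈v₁ , trans (proj₂≈eval u∈U) (trans (eval-cong u₁≈v₁) (sym (proj₂≈eval v∈U)))

    -- Two multiples of `P` have vanishing determinant. On the graph the second coordinates are
    -- values of `f`, so this is the equality of slopes after clearing denominators.
    equal-slopes : ∀ {u v} → u ∈ U → v ∈ U → (u₁≉0 : ¬ (proj₁ u ≈ 0#)) (v₁≉0 : ¬ (proj₁ v ≈ 0#)) →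
                   slope f (proj₁ u , u₁≉0) ≈ slope f (proj₁ v , v₁≉0)
    equal-slopes {u} {v} u∈U@(_ , k , u₁≈ , u₂≈) v∈U@(_ , l , v₁≈ , v₂≈) u₁≉0 v₁≉0 =
      cross-multiply _ _ _ _ (begin
      eval f (proj₁ u) * proj₁ v  ≈⟨ *-congʳ (proj₂≈eval u∈U) ⟨
      proj₂ u * proj₁ v           ≈⟨ *-cong u₂≈ v₁≈ ⟩
      (k * P₂) * (l * P₁)         ≈⟨ solve 4 (λ k l x y → (k :* y) :* (l :* x) := (l :* y) :* (k :* x)) refl k l P₁ P₂ ⟩
      (l * P₂) * (k * P₁)         ≈⟨ *-cong v₂≈ u₁≈ ⟨
      proj₂ v * proj₁ u           ≈⟨ *-congʳ (proj₂≈eval v∈U) ⟩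
      eval f (proj₁ v) * proj₁ u  ∎)
      where open SemiringSolver commutativeSemiring using (solve; _:*_; _:=_)

    -- A vector of `U` with first coordinate 0 agrees there with `0ᴹ`, hence equals it. This
    -- supplies the denominator for the bound in (ii).
    basis-head≉0 : ∀ {w} {b : Vector Carrierᴹ (suc w)} → LinearlyIndependent K Fq K² b → (∀ i → b i ∈ U) →
                   ¬ (proj₁ (b zero) ≈ 0#)
    basis-head≉0 {b = b} b-indep b∈U y≈0 =
      independent⇒head≉0 {b = b} b-indep (proj₁-injective (b∈U zero) 0ᴹ-closed y≈0)

    module _ {w} {b : Vector Carrierᴹ w} (b-indep : LinearlyIndependent K Fq K² b) (b∈U : ∀ i → b i ∈ U) where
      private
        y : Fin (q ℕ.^ w) → Carrier
        y k = proj₁ (enumerate b k)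

        enumerate∈U : ∀ k → enumerate b k ∈ U
        enumerate∈U k = lin-closed (coefficients∈F w k) b∈U

        y-injective : ∀ {k l} → y k ≈ y l → k ≡ l
        y-injective {k} {l} yk≈yl =
          enumerate-injective b-indep (proj₁-injective (enumerate∈U k) (enumerate∈U l) yk≈yl)

      module _ {s′} {t} (Fqt : Subfield K s′) (Fqt-order : HasOrder (Subfield.subsetoid Fqt) (q ℕ.^ t)) where
        private
          module Fqt = Subfield Fqt
          module Fqt-finite = FiniteSetoid Fqt.subsetoid Fqt-order

        weight≤t : (v : Carrierᴹ) → v ∈ U → ¬ (proj₁ v ≈ 0#) → LPartiallyScattered Fqt f → w ≤ t
        weight≤t v v∈U v₁≉0 L = ^-cancelʳ-≤ 1<q
          (Fqt-finite.injective⇒≤ (λ k → y k / v₁ , ratio∈Fqt k) λ {k} {l} eq → y-injective (begin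
            y k                  ≈⟨ /-*-cancel (y k) v₁ ⟨
            y k / v₁ * proj₁ v   ≈⟨ *-congʳ eq ⟩
            y l / v₁ * proj₁ v   ≈⟨ /-*-cancel (y l) v₁ ⟩
            y l                  ∎))
          where
          v₁ : Carrier*
          v₁ = proj₁ v , v₁≉0

          ratio∈Fqt : ∀ k → (y k / v₁) ∈ Fqt.⟦_⟧
          ratio∈Fqt k with y k ≟ 0#
          -- Scatteredness speaks of nonzero elements only; the zero vector contributes the quotient
          -- 0.
          ... | yes yk≈0 = Fqt.resp (sym (trans (*-congʳ yk≈0) (zeroˡ _))) Fqt.0-closed
          ... | no yk≉0  = L (y k , yk≉0) v₁ (equal-slopes (enumerate∈U k) v∈U yk≉0 v₁≉0)

        2*weight≤n : ∀ {μ} → μ ∈ Fqt.⟦_⟧ → μ ∉ ⟦_⟧ → RPartiallyScattered Fq Fqt f → 2 ℕ.* w ≤ n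
        2*weight≤n {μ} μ∈Fqt μ∉Fq R = ^-cancelʳ-≤ 1<q (≡.subst (_≤ q ℕ.^ n) q^w*q^w≡q^2w
          (injective⇒≤ g g-injective))
          where
          q^w*q^w≡q^2w : q ℕ.^ w ℕ.* q ℕ.^ w ≡ q ℕ.^ (2 ℕ.* w)
          q^w*q^w≡q^2w = ≡.trans (≡.sym (ℕ.^-distribˡ-+-* q w w))
            (≡.cong (λ m → q ℕ.^ (w ℕ.+ m)) (≡.sym (ℕ.+-identityʳ w)))

          μ≉0 : ¬ (μ ≈ 0#)
          μ≉0 μ≈0 = μ∉Fq (resp (sym μ≈0) 0-closed)

          -- If the first coordinate of `v` were nonzero, the two first coordinates would have equal
          -- slopes and ratio μ in F_{q^t}, so R-scatteredness would force μ into F_q.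
          trivial-meet : ∀ {u v} → u ∈ U → v ∈ U → proj₁ u ≈ μ * proj₁ v → proj₁ v ≈ 0#
          trivial-meet {u} {v} u∈U v∈U u₁≈μv₁ with proj₁ v ≟ 0#
          ... | yes v₁≈0 = v₁≈0
          ... | no v₁≉0  = contradiction (resp u₁/v₁≈μ
                  (R (proj₁ u , u₁≉0) (proj₁ v , v₁≉0) (equal-slopes u∈U v∈U u₁≉0 v₁≉0) (Fqt.resp (sym u₁/v₁≈μ) μ∈Fqt)))
                  μ∉Fq
            where
            u₁≉0 : ¬ (proj₁ u ≈ 0#)
            u₁≉0 u₁≈0 = *-nonZero μ≉0 v₁≉0 (trans (sym u₁≈μv₁) u₁≈0)

            u₁/v₁≈μ : proj₁ u / (proj₁ v , v₁≉0) ≈ μ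
            u₁/v₁≈μ = trans (*-congʳ u₁≈μv₁) (*-/-cancel μ (proj₁ v , v₁≉0))

          -- `U` is closed under subtraction. The difference is recorded additively so that later
          -- rearrangements stay within semiring identities.
          y-difference : ∀ k l → Σ[ u ∈ Carrierᴹ ] (u ∈ U × proj₁ u + y l ≈ y k)
          y-difference k l = (enumerate b k +ᴹ (- 1# *ₗ enumerate b l)) ,
            +ᴹ-closed (enumerate∈U k) (*ₗ-closed (neg-closed 1-closed) (enumerate∈U l)) ,
            (begin
            y k + - 1# * y l + y l    ≈⟨ +-congʳ (+-congˡ (-1*x≈-x (y l))) ⟩
            y k + - y l + y l         ≈⟨ //-rightDividesˡ (y l) (y k) ⟩
            y k                       ∎)
            where
            open RingProperties ring using (-1*x≈-x)
            open GroupProperties +-group using (//-rightDividesˡ)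

          g : Fin (q ℕ.^ w ℕ.* q ℕ.^ w) → Carrier
          g i = let (k , k′) = remQuot (q ℕ.^ w) i in y k + μ * y k′

          sum-injective : ∀ k k′ l l′ → y k + μ * y k′ ≈ y l + μ * y l′ → k ≡ l × k′ ≡ l′
          -- The second difference is taken in the opposite order, so that `eq` becomes
          -- `proj₁ u ≈ μ * proj₁ v` with no sign.
          sum-injective k k′ l l′ eq with y-difference k l | y-difference l′ k′
          ... | u , u∈U , u₁+yl≈yk | v , v∈U , v₁+yk′≈yl′ = k≡l , k′≡l′
            where
            open GroupProperties +-group using (∙-cancelʳ)
            open SemiringSolver commutativeSemiring using (solve; _:+_; _:*_; _:=_)

            k′≡l′ : k′ ≡ l′
            k′≡l′ = y-injective (begin
              y k′            ≈⟨ +-identityˡ _ ⟨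
              0# + y k′       ≈⟨ +-congʳ (trivial-meet u∈U v∈U (∙-cancelʳ (y l + μ * y k′) _ _ (begin
                proj₁ u + (y l + μ * y k′)          ≈⟨ +-assoc _ _ _ ⟨
                proj₁ u + y l + μ * y k′            ≈⟨ +-congʳ u₁+yl≈yk ⟩
                y k + μ * y k′                      ≈⟨ eq ⟩
                y l + μ * y l′                      ≈⟨ +-congˡ (*-congˡ v₁+yk′≈yl′) ⟨
                y l + μ * (proj₁ v + y k′)          ≈⟨ solve 4 (λ m a b c → a :+ m :* (b :+ c) := m :* b :+ (a :+ m :* c)) refl μ (y l) (proj₁ v) (y k′) ⟩
                μ * proj₁ v + (y l + μ * y k′)      ∎))) ⟨
              proj₁ v + y k′  ≈⟨ v₁+yk′≈yl′ ⟩
              y l′            ∎)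

            k≡l : k ≡ l
            k≡l = y-injective (∙-cancelʳ (μ * y k′) _ _
              (trans eq (+-congˡ (*-congˡ (reflexive (≡.cong y (≡.sym k′≡l′)))))))

          g-injective : ∀ {i j} → g i ≈ g j → i ≡ j
          g-injective {i} {j} eq =
            let (k≡l , k′≡l′) = sum-injective _ _ _ _ eq in
            ≡.trans (≡.sym (Fin.combine-remQuot {q ℕ.^ w} (q ℕ.^ w) i))
              (≡.trans (≡.cong₂ combine k≡l k′≡l′) (Fin.combine-remQuot {q ℕ.^ w} (q ℕ.^ w) j))

-- An element separating the subfields, and the theorem.

larger-subfield : ∀ {c ℓ s s′} (K : Field c ℓ) (let open Field K) {N} → HasOrder setoid N →
                  (F : Subfield K s) (E : Subfield K s′) → ∀ {m m′} →
                  HasOrder (Subfield.subsetoid F) m → HasOrder (Subfield.subsetoid E) m′ → m < m′ →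
                  ∃[ μ ] (μ ∈ Subfield.⟦_⟧ E × μ ∉ Subfield.⟦_⟧ F)
larger-subfield K K-order F E {m} {m′} F-order E-order m<m′ =
  let (i , i∉F) = Fin.¬∀⟶∃¬ m′ (λ i → proj₁ (E′.element i) ∈ Subfield.⟦_⟧ F)
                    (λ i → member? F F-order (proj₁ (E′.element i))) ¬E⊆F
  in proj₁ (E′.element i) , proj₂ (E′.element i) , i∉F
  where
  open FiniteField K K-order using (member?)
  module E′ = FiniteSetoid (Subfield.subsetoid E) E-order
  module F′ = FiniteSetoid (Subfield.subsetoid F) F-order

  -- Pigeonhole: containment would turn the enumeration of `E` into an injection of `m′` indices
  -- into `F`, giving m′ ≤ m.
  ¬E⊆F : ¬ (∀ i → proj₁ (E′.element i) ∈ Subfield.⟦_⟧ F)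
  ¬E⊆F E⊆F = ℕ.<⇒≱ m<m′ (F′.injective⇒≤ (λ i → proj₁ (E′.element i) , E⊆F i) (Bijection.injective E-order))

open import Data.Nat.Base using (_*_; _^_)

proposition3p4 : ∀ {c ℓ s s′ : Level} (q n t : ℕ) →
    IsPrimePower q → 1 ≤ n → t ∣ n → 1 < t → t < n →
    (K : Field c ℓ) → HasOrder (Field.setoid K) (q ^ n) →
    (Fq : Subfield K s) → HasOrder (Subfield.subsetoid Fq) q →
    (Fqt : Subfield K s′) → HasOrder (Subfield.subsetoid Fqt) (q ^ t) →
    let open QPolynomials K q n in
    (f : QPolynomial) →
    (RPartiallyScattered Fq Fqt f → (P : Point) → ∃[ w ] (HasWeight Fq f P w × 2 * w ≤ n))
    ×
    (LPartiallyScattered Fqt f → (P : Point) → ∃[ w ] (HasWeight Fq f P w × w ≤ t))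
proposition3p4 q n t q-pp _ _ 1<t _ K K-order Fq Fq-order Fqt Fqt-order f = R-bound , L-bound
  where
  open QPolynomials K q n
  open PointWeights q n q-pp K K-order Fq Fq-order f

  -- The nontriviality `1 < t` enters here: it provides μ in F_{q^t} outside F_q.
  q<q^t : q < q ^ t
  q<q^t = ≡.subst (_< q ^ t) (ℕ.^-identityʳ q) (ℕ.^-monoʳ-< q 1<q 1<t)

  R-bound : RPartiallyScattered Fq Fqt f → (P : Point) → ∃[ w ] (HasWeight Fq f P w × 2 * w ≤ n)
  R-bound R P with larger-subfield K K-order Fq Fqt Fq-order Fqt-order q<q^t | weight-basis P
  ... | μ , μ∈Fqt , μ∉Fq | w , b , b-basis , b∈U =
    w , (b , b-basis) , 2*weight≤n P (proj₁ b-basis) b∈U {t = t} Fqt Fqt-order μ∈Fqt μ∉Fq R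

  L-bound : LPartiallyScattered Fqt f → (P : Point) → ∃[ w ] (HasWeight Fq f P w × w ≤ t)
  L-bound L P with weight-basis P
  -- In weight 0 there is no nonzero vector to divide by; in positive weight the head of the basis
  -- serves.
  ... | zero  , b , b-basis , b∈U = zero , (b , b-basis) , z≤n
  ... | suc w , b , b-basis , b∈U = suc w , (b , b-basis) ,
    weight≤t P (proj₁ b-basis) b∈U {t = t} Fqt Fqt-order (b zero) (b∈U zero)
      (basis-head≉0 P (proj₁ b-basis) b∈U) L
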